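{- A computon $\lambda$ is a connected computon if and only if a tail-iterative computon $(\lambda)*_\rho$ exists for some t-diagram $\rho$ (in which $\lambda$ is the computon being iterated over).
   Context: $\mathbf{Set}$ is the category of finite sets and total functions. A computon $\lambda$ is a tuple $(U,P,I,O,\Sigma,\sigma,\tau,t,s,c)$ (a functor into $\mathbf{Set}$ from the free category on the arrows $\sigma:O\to U$, $\tau:I\to U$, $t:O\to P$, $s:I\to P$, $c:P\to\Sigma$) where $U$ (computation units), $I$ and $O$ (edges) are possibly empty finite sets, $P$ (ports) is a non-empty finite set, $\Sigma\subset\mathbb{N}$ (colours) is finite with $0\in\Sigma$, the functions $\sigma,\tau,c$ are surjective, and: the restrictions $\sigma|_{(c\circ t)^{ -1}(0)}$ and $\tau|_{(c\circ s)^{ -1}(0)}$ are surjective onto $U$; there is $p\in P\setminus \mathrm{Im}(s)$ with $c(p)=0$; there is $q\in P\setminus \mathrm{Im}(t)$ with $c(q)=0$. Components of $\lambda_j$ carry the subscript $j$. Put $P^+=P\setminus \mathrm{Im}(t)$ (e-inports) and $P^-=P\setminus \mathrm{Im}(s)$ (e-outports). Write $p\xrightarrow{i}u$ if $s(i)=p,\ \tau(i)=u$, and $u\xrightarrow{o}p$ if $\sigma(o)=u,\ t(o)=p$. For a port $p$, $\bullet p=\{u\in U\mid \exists o\in O,\ u\xrightarrow{o}p\}$ and $p\bullet=\{u\in U\mid\exists i\in I,\ p\xrightarrow{i}u\}$. Write $p_1\xrightarrow{\exists}p_n$ if there is a chain $p_1\xrightarrow{i_1}u_1\xrightarrow{o_1}p_2\cdots\xrightarrow{i_{n-1}}u_{n-1}\xrightarrow{o_{n-1}}p_n$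 with $n\ge 2$. A computon is connected if for each $p\in \mathrm{Im}(s)\cup P^+$ there is $q\in P^-$ with $p\xrightarrow{\exists}q$. A computon morphism $\alpha:\lambda_1\to\lambda_2$ is a natural transformation (functions $\alpha_U,\alpha_P,\alpha_I,\alpha_O,\alpha_\Sigma$ commuting with $\sigma,\tau,t,s,c$) such that $\alpha_\Sigma$ is the inclusion $\Sigma_1\subseteq\Sigma_2$ and $\vec{i}(\alpha)\cup\vec{o}(\alpha)\subseteq P_1^+\cup P_1^-$, where $\vec{i}(\alpha)=\{p\in P_1\mid \bullet\alpha(p)\setminus\alpha(\bullet p)\ne\emptyset\}$ and $\vec{o}(\alpha)=\{p\in P_1\mid \alpha(p)\bullet\setminus\alpha(p\bullet)\neq\emptyset\}$. Here $\alpha(p)=\alpha_P(p)$ and $\alpha(A)$ is the image of a set $A$ of ports or units. Computons and computon morphisms form the category $\mathbf{Set}^{\mathbf{Comp}}$ (componentwise composition). In this category, colimits (when they exist) are computed componentwise in $\mathbf{Set}$ on $U,P,I,O$, with the $\Sigma$-component being the union of the colour sets and with the induced structure functions. A trivial computon is one with $U=I=O=\emptyset$. An in-marker of a computon $\lambda$ is a computon monomorphism $\lambda^+:\lambda_0\to\lambda$ with $\lambda_0$ a trivial computon and $\lambda^+(P_0)=P^+$; an out-marker of $\lambda$ is a computon monomorphism $\lambda^-:\lambda_0\to\lambda$ with $\lambda_0$ trivial and $\lambda^-(P_0)=P^-$. A t-diagram $\rho$ is a diagram in $\mathbf{Set}^{\mathbf{Comp}}$ consisting of trivial computons $\lambda_0,\lambda_1$,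 connected computons $\lambda,\lambda_2,\lambda_3,\lambda_4$, and the markers $\lambda_2^-:\lambda_0\to\lambda_2$, $\lambda_3^-:\lambda_0\to\lambda_3$, $\lambda^+:\lambda_0\to\lambda$, $\lambda_3^+:\lambda_1\to\lambda_3$, $\lambda_4^+:\lambda_1\to\lambda_4$, $\lambda^-:\lambda_1\to\lambda$ (superscript $+$ denotes an in-marker, $-$ an out-marker, of the computon named). A tail-iterative computon is the colimit of a t-diagram; the colimit of this $\rho$ is denoted $(\lambda)*_\rho$.
   Formalization: The colimit is taken to be the componentwise one, with legs that are computon morphisms; the mediating map to another cocone need only be a natural transformation and need not satisfy the boundary condition, since with that condition no t-diagram has a colimit. -}

module Defs where

open import Data.Bool.Base using (Bool; true; false)
open import Data.Bool.Properties using (T-≡)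
open import Data.Fin.Base using (Fin; zero; suc)
open import Data.List.Base using (List)
open import Data.List.Membership.Propositional using () renaming (_∈_ to _∈ˡ_)
import Data.List.Relation.Binary.Subset.Propositional as List
open import Data.Nat.Base using (ℕ; _≡ᵇ_)
open import Data.Nat.Properties using (≡ᵇ⇒≡; ≡⇒≡ᵇ)
open import Data.Product using (Σ-syntax; ∃; ∃-syntax; _×_; _,_; proj₁; proj₂)
open import Function.Base using (_∘_; const)
open import Function.Bundles using (_↔_; _⇔_; mk↔ₛ′; module Equivalence)
open import Function.Definitions using (StrictlySurjective)
open import Level using (0ℓ)
open import Relation.Binary.Construct.Closure.Transitive using (TransClosure)
open import Relation.Binary.PropositionalEquality
  using (_≡_; refl; sym; trans; cong; _≗_)
open import Relation.Nullary using (¬_)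
open import Relation.Unary using (Pred; _∈_; _⊆_; _≐_; _∪_; _∖_; ∁; Satisfiable)

Finite : Set → Set
Finite A = ∃[ n ] (A ↔ Fin n)

image : {A B : Set} → (A → B) → Pred A 0ℓ → Pred B 0ℓ
image f X b = ∃[ a ] (a ∈ X × f a ≡ b)

Im : {A B : Set} → (A → B) → Pred B 0ℓ
Im f b = ∃[ a ] f a ≡ b

-- The finite set Σ ⊂ ℕ is given by a list of which only the membership
-- relation is ever used.  The function c : P → Σ is a function to ℕ together
-- with a proof that its values lie in Σ.
record Computon : Set₁ where
  field
    U P I O  : Set
    U-finite : Finite U
    P-finite : Finite P
    I-finite : Finite I
    O-finite : Finite O
    P-point  : P
    Colours  : List ℕ
    0∈Σ      : 0 ∈ˡ Colours
    σ        : O → U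
    τ        : I → U
    t        : O → P
    s        : I → P
    c        : P → ℕ
    c-∈      : ∀ p → c p ∈ˡ Colours
    σ-surj   : StrictlySurjective _≡_ σ
    τ-surj   : StrictlySurjective _≡_ τ
    c-surj   : ∀ {n} → n ∈ˡ Colours → ∃[ p ] c p ≡ n
    σ₀-surj  : ∀ u → ∃[ o ] (c (t o) ≡ 0 × σ o ≡ u)
    τ₀-surj  : ∀ u → ∃[ i ] (c (s i) ≡ 0 × τ i ≡ u)
    P⁻-control : ∃[ p ] (p ∈ ∁ (Im s) × c p ≡ 0)
    P⁺-control : ∃[ q ] (q ∈ ∁ (Im t) × c q ≡ 0)

  P⁺ P⁻ : Pred P 0ℓ
  P⁺ = ∁ (Im t)
  P⁻ = ∁ (Im s)

  _-[_]→ᵢ_ : P → I → U → Set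
  p -[ i ]→ᵢ u = s i ≡ p × τ i ≡ u

  _-[_]→ₒ_ : U → O → P → Set
  u -[ o ]→ₒ p = σ o ≡ u × t o ≡ p

  -- •p and p•
  pre post : P → Pred U 0ℓ
  pre  p u = ∃[ o ] (u -[ o ]→ₒ p)
  post p u = ∃[ i ] (p -[ i ]→ᵢ u)

  _⟶_ : P → P → Set
  p ⟶ q = ∃[ i ] ∃[ u ] ∃[ o ] (p -[ i ]→ᵢ u × u -[ o ]→ₒ q)

  _⟶⁺_ : P → P → Set
  _⟶⁺_ = TransClosure _⟶_

open Computon

Connected : Computon → Set
Connected K = ∀ p → p ∈ (Im (s K) ∪ P⁺ K) → ∃[ q ] (q ∈ P⁻ K × _⟶⁺_ K p q)

Trivial : Computon → Set
Trivial K = ¬ U K × ¬ I K × ¬ O K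

-- A natural transformation whose Σ-component is the inclusion Σ₁ ⊆ Σ₂;
-- naturality at c then says that colours are preserved.
record Transformation (K L : Computon) : Set where
  field
    mapU : U K → U L
    mapP : P K → P L
    mapI : I K → I L
    mapO : O K → O L
    Σ⊆   : Colours K List.⊆ Colours L
    σ-natural : ∀ o → σ L (mapO o) ≡ mapU (σ K o)
    τ-natural : ∀ i → τ L (mapI i) ≡ mapU (τ K i)
    t-natural : ∀ o → t L (mapO o) ≡ mapP (t K o)
    s-natural : ∀ i → s L (mapI i) ≡ mapP (s K i)
    c-natural : ∀ p → c L (mapP p) ≡ c K p

open Transformation

infix 4 _≈ₜ_

record _≈ₜ_ {K L : Computon} (α β : Transformation K L) : Set where
  constructor mk≈ₜ
  field
    ≈U : mapU α ≗ mapU β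
    ≈P : mapP α ≗ mapP β
    ≈I : mapI α ≗ mapI β
    ≈O : mapO α ≗ mapO β

open _≈ₜ_

infixr 9 _∘ₜ_

_∘ₜ_ : ∀ {K L M} → Transformation L M → Transformation K L → Transformation K M
β ∘ₜ α = record
  { mapU = mapU β ∘ mapU α
  ; mapP = mapP β ∘ mapP α
  ; mapI = mapI β ∘ mapI α
  ; mapO = mapO β ∘ mapO α
  ; Σ⊆ = λ m → Σ⊆ β (Σ⊆ α m)
  ; σ-natural = λ o → trans (σ-natural β _) (cong (mapU β) (σ-natural α o))
  ; τ-natural = λ i → trans (τ-natural β _) (cong (mapU β) (τ-natural α i))
  ; t-natural = λ o → trans (t-natural β _) (cong (mapP β) (t-natural α o))
  ; s-natural = λ i → trans (s-natural β _) (cong (mapP β) (s-natural α i))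
  ; c-natural = λ p → trans (c-natural β _) (c-natural α p)
  }

i⃗ o⃗ : ∀ {K L} → Transformation K L → Pred (P K) 0ℓ
i⃗ {K} {L} α p = Satisfiable (pre L (mapP α p) ∖ image (mapU α) (pre K p))
o⃗ {K} {L} α p = Satisfiable (post L (mapP α p) ∖ image (mapU α) (post K p))

record Morphism (K L : Computon) : Set where
  field
    transformation : Transformation K L
    boundary       : (i⃗ transformation ∪ o⃗ transformation) ⊆ (P⁺ K ∪ P⁻ K)

open Morphism

Mono : ∀ {K L} → Morphism K L → Set₁
Mono {K} α = ∀ {M} (f g : Morphism M K) →
  transformation α ∘ₜ transformation f ≈ₜ transformation α ∘ₜ transformation g →
  transformation f ≈ₜ transformation g

record InMarker (K₀ K : Computon) : Set₁ where
  field
    trivial  : Trivial K₀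
    morphism : Morphism K₀ K
    mono     : Mono morphism
    onto     : Im (mapP (transformation morphism)) ≐ P⁺ K

record OutMarker (K₀ K : Computon) : Set₁ where
  field
    trivial  : Trivial K₀
    morphism : Morphism K₀ K
    mono     : Mono morphism
    onto     : Im (mapP (transformation morphism)) ≐ P⁻ K

record Shape : Set₁ where
  field
    Vertex Edge   : Set
    source target : Edge → Vertex

open Shape

record Diagram (S : Shape) : Set₁ where
  field
    obj : Vertex S → Computon
    arr : ∀ e → Morphism (obj (source S e)) (obj (target S e))

  arrₜ : ∀ e → Transformation (obj (source S e)) (obj (target S e))
  arrₜ e = transformation (arr e)

open Diagram

record Cocone {S : Shape} (D : Diagram S) (K : Computon) : Set where
  field
    leg      : ∀ j → Morphism (obj D j) K

  legₜ : ∀ j → Transformation (obj D j) K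
  legₜ j = transformation (leg j)

  field
    commutes : ∀ e → legₜ (target S e) ∘ₜ arrₜ D e ≈ₜ legₜ (source S e)

open Cocone

-- The universal property, in finite sets, of a cocone ι on the diagram (X , f).
IsSetColimit : (S : Shape) (X : Vertex S → Set)
               (f : ∀ e → X (source S e) → X (target S e))
               (L : Set) (ι : ∀ j → X j → L) → Set₁
IsSetColimit S X f L ι =
  (Y : Set) → Finite Y →
  (g : ∀ j → X j → Y) → (∀ e → g (target S e) ∘ f e ≗ g (source S e)) →
  Σ[ h ∈ (L → Y) ] ((∀ j → h ∘ ι j ≗ g j) ×
                    (∀ h′ → (∀ j → h′ ∘ ι j ≗ g j) → h′ ≗ h))

-- Colimits of computons are the componentwise ones: the apex and the legs are
-- in the category of computons, the components at U, P, I, O are colimits of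
-- finite sets, and the colours are the union.  The structure functions of the
-- apex are then the induced ones, by naturality of the legs.
--
-- The mediating transformation to another cocone (see `mediate`) need not have
-- its i⃗ and o⃗ contained in the boundary of the apex: a cocone may attach a new
-- unit to a port at which the diagram has been glued.  Universality among
-- computon morphisms only is therefore not the notion used here.
record IsColimit {S : Shape} {D : Diagram S} {K : Computon} (κ : Cocone D K) : Set₁ where
  field
    colimU : IsSetColimit S (U ∘ obj D) (λ e → mapU (arrₜ D e)) (U K) (λ j → mapU (legₜ κ j))
    colimP : IsSetColimit S (P ∘ obj D) (λ e → mapP (arrₜ D e)) (P K) (λ j → mapP (legₜ κ j))
    colimI : IsSetColimit S (I ∘ obj D) (λ e → mapI (arrₜ D e)) (I K) (λ j → mapI (legₜ κ j))
    colimO : IsSetColimit S (O ∘ obj D) (λ e → mapO (arrₜ D e)) (O K) (λ j → mapO (legₜ κ j))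
    unionΣ : ∀ n → n ∈ˡ Colours K ⇔ (∃[ j ] n ∈ˡ Colours (obj D j))

data TVertex : Set where
  v₀ v₁ v v₂ v₃ v₄ : TVertex

-- An edge bears the name of the marker it carries.
data TEdge : Set where
  e₂⁻ e₃⁻ e⁺ e₃⁺ e₄⁺ e⁻ : TEdge

TShape : Shape
TShape = record
  { Vertex = TVertex
  ; Edge   = TEdge
  ; source = λ { e₂⁻ → v₀ ; e₃⁻ → v₀ ; e⁺ → v₀ ; e₃⁺ → v₁ ; e₄⁺ → v₁ ; e⁻ → v₁ }
  ; target = λ { e₂⁻ → v₂ ; e₃⁻ → v₃ ; e⁺ → v  ; e₃⁺ → v₃ ; e₄⁺ → v₄ ; e⁻ → v  }
  }

-- The t-diagrams in which K is the computon iterated over.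
record TDiagram (K : Computon) : Set₁ where
  field
    K₀ K₁ K₂ K₃ K₄ : Computon
    K₀-trivial   : Trivial K₀
    K₁-trivial   : Trivial K₁
    K-connected  : Connected K
    K₂-connected : Connected K₂
    K₃-connected : Connected K₃
    K₄-connected : Connected K₄
    K₂⁻ : OutMarker K₀ K₂
    K₃⁻ : OutMarker K₀ K₃
    K⁺  : InMarker  K₀ K
    K₃⁺ : InMarker  K₁ K₃
    K₄⁺ : InMarker  K₁ K₄
    K⁻  : OutMarker K₁ K

  diagram : Diagram TShape
  diagram = record
    { obj = λ { v₀ → K₀ ; v₁ → K₁ ; v → K ; v₂ → K₂ ; v₃ → K₃ ; v₄ → K₄ }
    ; arr = λ { e₂⁻ → OutMarker.morphism K₂⁻
              ; e₃⁻ → OutMarker.morphism K₃⁻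
              ; e⁺  → InMarker.morphism K⁺
              ; e₃⁺ → InMarker.morphism K₃⁺
              ; e₄⁺ → InMarker.morphism K₄⁺
              ; e⁻  → OutMarker.morphism K⁻ }
    }

-- The tail-iterative computons (K)*ᵨ.
record TailIterative {K : Computon} (ρ : TDiagram K) : Set₁ where
  field
    computon  : Computon
    cocone    : Cocone (TDiagram.diagram ρ) computon
    isColimit : IsColimit cocone

Bool-finite : Finite Bool
Bool-finite = 2 , mk↔ₛ′ to from to∘from from∘to
  where
  to : Bool → Fin 2
  to false = zero
  to true  = suc zero
  from : Fin 2 → Bool
  from zero    = false
  from (suc _) = true
  to∘from : ∀ x → to (from x) ≡ x
  to∘from zero       = refl
  to∘from (suc zero) = refl
  from∘to : ∀ x → from (to x) ≡ x
  from∘to false = refl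
  from∘to true  = refl

-- A colimit is universal, with respect to transformations, among cocones.
module _ {S : Shape} {D : Diagram S} {K : Computon} (κ : Cocone D K)
         (κ-colim : IsColimit κ) where

  open IsColimit κ-colim

  private
    unique : ∀ {X f L ι} → IsSetColimit S X f L ι → {Y : Set} → Finite Y →
             (a b : L → Y) (ι-cocone : ∀ e x → ι (target S e) (f e x) ≡ ι (source S e) x) →
             (∀ j x → a (ι j x) ≡ b (ι j x)) → a ≗ b
    unique {ι = ι} colim fin a b ι-cocone eq x =
      let _ , _ , uniq = colim _ fin (λ j → b ∘ ι j) (λ e y → cong b (ι-cocone e y))
      in trans (uniq a eq x) (sym (uniq b (λ _ _ → refl) x))

    -- ℕ is not finite, so the test is done in Bool.
    uniqueℕ : ∀ {X f L ι} → IsSetColimit S X f L ι →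
              (a b : L → ℕ) (ι-cocone : ∀ e x → ι (target S e) (f e x) ≡ ι (source S e) x) →
              (∀ j x → a (ι j x) ≡ b (ι j x)) → a ≗ b
    uniqueℕ {ι = ι} colim a b ι-cocone eq x =
      ≡ᵇ⇒≡ (a x) (b x) (Equivalence.from T-≡ (unique colim Bool-finite
        (λ y → a y ≡ᵇ b y) (const true) ι-cocone
        (λ j y → Equivalence.to T-≡ (≡⇒≡ᵇ (a (ι j y)) (b (ι j y)) (eq j y))) x))

  mediate : ∀ {L} (μ : Cocone D L) →
    Σ[ h ∈ Transformation K L ]
      ((∀ j → h ∘ₜ legₜ κ j ≈ₜ legₜ μ j) ×
       (∀ h′ → (∀ j → h′ ∘ₜ legₜ κ j ≈ₜ legₜ μ j) → h′ ≈ₜ h))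
  mediate {L} μ =
      record
        { mapU = hU ; mapP = hP ; mapI = hI ; mapO = hO
        ; Σ⊆ = λ n∈ → let j , n∈j = Equivalence.to (unionΣ _) n∈ in Σ⊆ (legₜ μ j) n∈j
        ; σ-natural = unique colimO (U-finite L) _ _ (λ e → ≈O (commutes κ e)) λ j x →
            trans (cong (σ L) (fO j x)) (trans (σ-natural (legₜ μ j) x)
              (trans (sym (fU j _)) (cong hU (sym (σ-natural (legₜ κ j) x)))))
        ; τ-natural = unique colimI (U-finite L) _ _ (λ e → ≈I (commutes κ e)) λ j x →
            trans (cong (τ L) (fI j x)) (trans (τ-natural (legₜ μ j) x)
              (trans (sym (fU j _)) (cong hU (sym (τ-natural (legₜ κ j) x)))))
        ; t-natural = unique colimO (P-finite L) _ _ (λ e → ≈O (commutes κ e)) λ j x →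
            trans (cong (t L) (fO j x)) (trans (t-natural (legₜ μ j) x)
              (trans (sym (fP j _)) (cong hP (sym (t-natural (legₜ κ j) x)))))
        ; s-natural = unique colimI (P-finite L) _ _ (λ e → ≈I (commutes κ e)) λ j x →
            trans (cong (s L) (fI j x)) (trans (s-natural (legₜ μ j) x)
              (trans (sym (fP j _)) (cong hP (sym (s-natural (legₜ κ j) x)))))
        ; c-natural = uniqueℕ colimP _ _ (λ e → ≈P (commutes κ e)) λ j x →
            trans (cong (c L) (fP j x)) (trans (c-natural (legₜ μ j) x)
              (sym (c-natural (legₜ κ j) x)))
        }
    , (λ j → mk≈ₜ (fU j) (fP j) (fI j) (fO j))
    , λ h′ eq → mk≈ₜ (uU (mapU h′) λ j → ≈U (eq j)) (uP (mapP h′) λ j → ≈P (eq j))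
                     (uI (mapI h′) λ j → ≈I (eq j)) (uO (mapO h′) λ j → ≈O (eq j))
    where
    medU = colimU (U L) (U-finite L) (λ j → mapU (legₜ μ j)) (λ e → ≈U (commutes μ e))
    medP = colimP (P L) (P-finite L) (λ j → mapP (legₜ μ j)) (λ e → ≈P (commutes μ e))
    medI = colimI (I L) (I-finite L) (λ j → mapI (legₜ μ j)) (λ e → ≈I (commutes μ e))
    medO = colimO (O L) (O-finite L) (λ j → mapO (legₜ μ j)) (λ e → ≈O (commutes μ e))
    hU = proj₁ medU
    hP = proj₁ medP
    hI = proj₁ medI
    hO = proj₁ medO
    fU = proj₁ (proj₂ medU)
    fP = proj₁ (proj₂ medP)
    fI = proj₁ (proj₂ medI)
    fO = proj₁ (proj₂ medO)
    uU = proj₂ (proj₂ medU)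
    uP = proj₂ (proj₂ medP)
    uI = proj₂ (proj₂ medI)
    uO = proj₂ (proj₂ medO)

{-# OPTIONS --safe #-}

-- The diagram ρ carries the connectedness of K, so only the construction of a
-- tail-iterative computon needs work.  For finite coloured sets A and B let
-- `unit A B` be the connected computon with a single unit, e-inports A and
-- e-outports B.  With A = P⁺ K, B = P⁻ K and a single port 1 of colour 0, take
-- K₂ = unit 1 A, K₃ = unit B A and K₄ = unit B 1.  The colimit then has the
-- ports 1 ⊎ P K ⊎ 1, while its units and edges are disjoint unions.  Every port
-- of a `unit` is an e-inport or an e-outport, and in K only ports of P⁺ K ∪ P⁻ K
-- acquire new edges, so the legs are computon morphisms.
module Submission where

open import Defs
open import Data.Empty using (⊥)
open import Data.Fin.Base using (Fin; zero; suc)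
open import Data.Fin.Properties using (_≟_; any?; 0↔⊥; 1↔⊤; +↔⊎)
open import Data.List.Base using (List; _++_; tabulate; filter; lookup; length)
open import Data.List.Membership.Propositional using () renaming (_∈_ to _∈ˡ_)
open import Data.List.Membership.Propositional.Properties
  using (∈-tabulate⁺; ∈-tabulate⁻; ∈-filter⁺; ∈-filter⁻; ∈-lookup; ∈-++⁺ˡ; ∈-++⁺ʳ; ∈-++⁻)
import Data.List.Relation.Binary.Subset.Propositional as List
import Data.List.Relation.Unary.All as All
open import Data.List.Relation.Unary.AllPairs using (_∷_)
open import Data.List.Relation.Unary.Any using (index)
open import Data.List.Relation.Unary.Any.Properties using (lookup-index)
open import Data.List.Relation.Unary.Unique.Propositional using (Unique)
open import Data.List.Relation.Unary.Unique.Propositional.Properties using (tabulate⁺; filter⁺)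
open import Data.Nat.Base using (ℕ)
open import Data.Product using (Σ-syntax; ∃; ∃-syntax; _×_; _,_; proj₁; proj₂)
open import Data.Sum.Base using (_⊎_; inj₁; inj₂; [_,_])
import Data.Sum.Base as Sum
open import Data.Sum.Function.Propositional using (_⊎-↔_)
open import Data.Sum.Properties using (inj₁-injective; inj₂-injective)
open import Data.Unit.Base using (⊤; tt)
open import Function.Base using (_∘_; const; id)
open import Function.Bundles using (_⇔_; mk⇔; module Inverse; module Injection)
open import Function.Definitions using (Injective)
open import Function.Properties.Inverse using (↔-refl; ↔-sym; ↔-trans; ↔⇒↣)
open import Level using (0ℓ)
open import Relation.Binary.Construct.Closure.Transitive using () renaming ([_] to [_]⁺)
open import Relation.Binary.Definitions using (DecidableEquality)
open import Relation.Binary.PropositionalEquality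
  using (_≡_; refl; sym; trans; cong; subst; _≗_)
open import Relation.Nullary using (¬_; contradiction)
open import Relation.Nullary.Decidable using (map′; via-injection; ¬?)
open import Relation.Unary using (Pred; Decidable; _∈_; _≐_)

open Computon
open Transformation
open Morphism

-- Finite sets and enumeration of decidable subsets

⊥-finite : Finite ⊥
⊥-finite = 0 , ↔-sym 0↔⊥

⊤-finite : Finite ⊤
⊤-finite = 1 , ↔-sym 1↔⊤

Fin-finite : ∀ n → Finite (Fin n)
Fin-finite n = n , ↔-refl

infixr 1 _⊎-finite_

_⊎-finite_ : {A B : Set} → Finite A → Finite B → Finite (A ⊎ B)
(_ , i) ⊎-finite (_ , j) = _ , ↔-trans (i ⊎-↔ j) (↔-sym +↔⊎)

finite⇒≟ : {A : Set} → Finite A → DecidableEquality A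
finite⇒≟ (_ , i) = via-injection (↔⇒↣ i) _≟_

-- `P⁺` and `P⁻` are complements of images, so deciding images by a finite search is what allows
-- them to be listed.
Im? : {A B : Set} → Finite A → Finite B → (f : A → B) → Decidable (Im f)
Im? (_ , i) B-finite f b =
  map′ (λ { (k , eq) → Inverse.from i k , eq })
       (λ { (a , eq) → Inverse.to i a , trans (cong f (Inverse.strictlyInverseʳ i a)) eq })
       (any? (λ k → finite⇒≟ B-finite (f (Inverse.from i k)) b))

lookup-injective : {A : Set} {xs : List A} → Unique xs → Injective _≡_ _≡_ (lookup xs)
lookup-injective (_  ∷ _) {zero}  {zero}  _  = refl
lookup-injective (x∉ ∷ _) {zero}  {suc j} eq = contradiction eq (All.lookup x∉ (∈-lookup j))
lookup-injective (x∉ ∷ _) {suc i} {zero}  eq = contradiction (sym eq) (All.lookup x∉ (∈-lookup i))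
lookup-injective (_  ∷ u) {suc i} {suc j} eq = cong suc (lookup-injective u eq)

-- The data of a marker at the level of ports: a finite set embedded with image exactly `Q`.
record Enumeration {A : Set} (Q : Pred A 0ℓ) : Set where
  field
    size      : ℕ
    at        : Fin size → A
    injective : Injective _≡_ _≡_ at
    range     : Im at ≐ Q

-- The bijection with `Fin n` lists `A` without repetition, filtering preserves this, and indexing a
-- repetition-free list is injective.
enumerate : {A : Set} {Q : Pred A 0ℓ} → Finite A → Decidable Q → Enumeration Q
enumerate {A} {Q} (_ , i) Q? = record
  { size      = length xs
  ; at        = lookup xs
  ; injective = lookup-injective (filter⁺ Q? (tabulate⁺ (Injection.injective (↔⇒↣ (↔-sym i)))))
  ; range     = (λ { (k , refl) → proj₂ (∈-filter⁻ Q? {xs = ys} (∈-lookup k)) })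
              , λ {a} q → let a∈xs = ∈-filter⁺ Q? (a∈ys a) q
                          in index a∈xs , sym (lookup-index a∈xs)
  }
  where
  ys xs : List A
  ys = tabulate (Inverse.from i)
  xs = filter Q? ys
  a∈ys : ∀ a → a ∈ˡ ys
  a∈ys a = subst (_∈ˡ ys) (Inverse.strictlyInverseʳ i a) (∈-tabulate⁺ (Inverse.to i a))

-- Coloured finite sets, trivial computons and one-unit computons

record Interface : Set where
  field
    size    : ℕ
    colour  : Fin size → ℕ
    -- A computon must have an e-inport and an e-outport of colour 0, so a set of ports that is to
    -- serve as all e-inports or all e-outports has to contain one.
    control : ∃[ k ] colour k ≡ 0

  colours : List ℕ
  colours = tabulate colour

  0∈colours : 0 ∈ˡ colours
  0∈colours = let k , eq = control in subst (_∈ˡ colours) eq (∈-tabulate⁺ k)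

open Interface

singleton : Interface
singleton = record { size = 1 ; colour = const 0 ; control = zero , refl }

trivial : Interface → Computon
trivial A = record
  { U = ⊥ ; P = Fin (size A) ; I = ⊥ ; O = ⊥
  ; U-finite = ⊥-finite ; P-finite = Fin-finite _ ; I-finite = ⊥-finite ; O-finite = ⊥-finite
  ; P-point = proj₁ (control A)
  ; Colours = colours A ; 0∈Σ = 0∈colours A
  ; σ = λ () ; τ = λ () ; t = λ () ; s = λ () ; c = colour A
  ; c-∈ = ∈-tabulate⁺
  ; σ-surj = λ () ; τ-surj = λ ()
  ; c-surj = λ n∈ → let k , eq = ∈-tabulate⁻ n∈ in k , sym eq
  ; σ₀-surj = λ () ; τ₀-surj = λ ()
  ; P⁻-control = let k , eq = control A in k , (λ ()) , eq
  ; P⁺-control = let k , eq = control A in k , (λ ()) , eq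
  }

trivial-trivial : ∀ A → Trivial (trivial A)
trivial-trivial _ = id , id , id

-- Edges are indexed by the ports they touch: each port of `A` feeds the unit once, and each port of
-- `B` is fed by it once.
unit : Interface → Interface → Computon
unit A B = record
  { U = ⊤ ; P = Fin (size A) ⊎ Fin (size B) ; I = Fin (size A) ; O = Fin (size B)
  ; U-finite = ⊤-finite ; P-finite = Fin-finite _ ⊎-finite Fin-finite _
  ; I-finite = Fin-finite _ ; O-finite = Fin-finite _
  ; P-point = inj₁ (proj₁ (control A))
  ; Colours = colours A ++ colours B ; 0∈Σ = ∈-++⁺ˡ (0∈colours A)
  ; σ = const tt ; τ = const tt ; t = inj₂ ; s = inj₁ ; c = [ colour A , colour B ]
  ; c-∈ = [ (λ k → ∈-++⁺ˡ (∈-tabulate⁺ k)) , (λ k → ∈-++⁺ʳ (colours A) (∈-tabulate⁺ k)) ]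
  ; σ-surj = λ _ → proj₁ (control B) , refl ; τ-surj = λ _ → proj₁ (control A) , refl
  ; c-surj = λ n∈ → [ (λ n∈A → let k , eq = ∈-tabulate⁻ n∈A in inj₁ k , sym eq)
                    , (λ n∈B → let k , eq = ∈-tabulate⁻ n∈B in inj₂ k , sym eq)
                    ] (∈-++⁻ (colours A) n∈)
  ; σ₀-surj = λ _ → let k , eq = control B in k , eq , refl
  ; τ₀-surj = λ _ → let k , eq = control A in k , eq , refl
  ; P⁻-control = let k , eq = control B in inj₂ k , (λ ()) , eq
  ; P⁺-control = let k , eq = control A in inj₁ k , (λ ()) , eq
  }

module _ (A B : Interface) where

  unit-P⁺ : Im inj₁ ≐ P⁺ (unit A B)
  unit-P⁺ = (λ { (_ , refl) () })
          , λ { {inj₁ k} _ → k , refl ; {inj₂ k} k∉ → contradiction (k , refl) k∉ }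

  unit-P⁻ : Im inj₂ ≐ P⁻ (unit A B)
  unit-P⁻ = (λ { (_ , refl) () })
          , λ { {inj₁ k} k∉ → contradiction (k , refl) k∉ ; {inj₂ k} _ → k , refl }

  -- This makes the boundary condition automatic for every transformation out of a `unit`.
  unit-P⁺∪P⁻ : ∀ p → p ∈ P⁺ (unit A B) ⊎ p ∈ P⁻ (unit A B)
  unit-P⁺∪P⁻ (inj₁ _) = inj₁ λ ()
  unit-P⁺∪P⁻ (inj₂ _) = inj₂ λ ()

  unit-connected : Connected (unit A B)
  unit-connected (inj₁ k) _ =
    let l , _ = control B in inj₂ l , (λ ()) , [ k , tt , l , (refl , refl) , refl , refl ]⁺
  -- The ports of `B` impose nothing: they lie outside `Im s`, and being in the image of `t` they
  -- are not e-inports.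
  unit-connected (inj₂ _) (inj₁ ())
  unit-connected (inj₂ k) (inj₂ k∉) = contradiction (k , refl) k∉

-- Morphisms out of trivial computons, and markers

module _ (A : Interface) (K : Computon) (f : Fin (size A) → P K)
         (f-colour : c K ∘ f ≗ colour A) where

  portMorphism : Morphism (trivial A) K
  portMorphism = record
    { transformation = record
        { mapU = λ () ; mapP = f ; mapI = λ () ; mapO = λ ()
        ; Σ⊆ = λ n∈ → let k , eq = ∈-tabulate⁻ n∈
                       in subst (_∈ˡ Colours K) (trans (f-colour k) (sym eq)) (c-∈ K (f k))
        ; σ-natural = λ () ; τ-natural = λ () ; t-natural = λ () ; s-natural = λ ()
        ; c-natural = f-colour
        }
    -- Without edges every port of `trivial A` is an e-inport.
    ; boundary = λ _ → inj₁ λ ()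
    }

  -- A computon mapping to a trivial one has no units or edges itself, so two such morphisms can
  -- differ only on ports, where `f` is cancelled.
  portMorphism-mono : Injective _≡_ _≡_ f → Mono portMorphism
  portMorphism-mono inj g h eq = mk≈ₜ
    (λ u → contradiction (mapU (transformation g) u) id)
    (λ p → inj (_≈ₜ_.≈P eq p))
    (λ i → contradiction (mapI (transformation g) i) id)
    (λ o → contradiction (mapO (transformation g) o) id)

  inMarker : Injective _≡_ _≡_ f → Im f ≐ P⁺ K → InMarker (trivial A) K
  inMarker inj onto = record
    { trivial = trivial-trivial A ; morphism = portMorphism
    ; mono = portMorphism-mono inj ; onto = onto }

  outMarker : Injective _≡_ _≡_ f → Im f ≐ P⁻ K → OutMarker (trivial A) K
  outMarker inj onto = record
    { trivial = trivial-trivial A ; morphism = portMorphism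
    ; mono = portMorphism-mono inj ; onto = onto }

-- Criteria for colimits of finite sets

Cocone-on : (S : Shape) (X : Shape.Vertex S → Set)
            (f : ∀ e → X (Shape.source S e) → X (Shape.target S e)) (Y : Set)
            (g : ∀ j → X j → Y) → Set
Cocone-on S X f Y g = ∀ e → g (Shape.target S e) ∘ f e ≗ g (Shape.source S e)

-- Joint surjectivity of `ι` already forces uniqueness of the mediating map, which leaves only a
-- factorisation to be supplied.
jointlySurjective⇒colimit :
  ∀ {S X f L ι} → (∀ l → ∃[ j ] ∃[ x ] ι j x ≡ l) →
  (∀ {Y} (g : ∀ j → X j → Y) → Cocone-on S X f Y g → Σ[ h ∈ (L → Y) ] (∀ j → h ∘ ι j ≗ g j)) →
  IsSetColimit S X f L ι
jointlySurjective⇒colimit surj factor _ _ g g-cocone =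
  let h , h-ι = factor g g-cocone
  in h , h-ι , λ h′ h′-ι l → let j , x , eq = surj l in
     trans (cong h′ (sym eq)) (trans (h′-ι j x) (trans (sym (h-ι j x)) (cong h eq)))

-- Serves for units and edges: the trivial computons have none, so nothing is identified and the
-- remaining four vertices contribute a disjoint union.
coproduct-colimit :
  ∀ {X f ι} → ¬ X v₀ → ¬ X v₁ →
  ι v₂ ≗ inj₁ → ι v ≗ inj₂ ∘ inj₁ → ι v₃ ≗ inj₂ ∘ inj₂ ∘ inj₁ → ι v₄ ≗ inj₂ ∘ inj₂ ∘ inj₂ →
  IsSetColimit TShape X f (X v₂ ⊎ X v ⊎ X v₃ ⊎ X v₄) ι
coproduct-colimit ¬v₀ ¬v₁ eq₂ eq eq₃ eq₄ = jointlySurjective⇒colimit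
  (λ { (inj₁ x)               → v₂ , x , eq₂ x
     ; (inj₂ (inj₁ x))        → v  , x , eq x
     ; (inj₂ (inj₂ (inj₁ x))) → v₃ , x , eq₃ x
     ; (inj₂ (inj₂ (inj₂ x))) → v₄ , x , eq₄ x })
  λ g _ → let h = [ g v₂ , [ g v , [ g v₃ , g v₄ ] ] ] in h ,
    λ { v₀ x → contradiction x ¬v₀
      ; v₁ x → contradiction x ¬v₁
      ; v₂ x → cong h (eq₂ x)
      ; v  x → cong h (eq x)
      ; v₃ x → cong h (eq₃ x)
      ; v₄ x → cong h (eq₄ x) }

-- The t-diagram over a connected computon

module _ (K : Computon) (K-connected : Connected K) where

  private
    module In  = Enumeration (enumerate (P-finite K) (λ p → ¬? (Im? (O-finite K) (P-finite K) (t K) p)))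
    module Out = Enumeration (enumerate (P-finite K) (λ p → ¬? (Im? (I-finite K) (P-finite K) (s K) p)))

    A B : Interface
    A = record { size = In.size ; colour = c K ∘ In.at
               -- The e-inport of colour 0 that `K` is guaranteed to have is located in the
               -- enumeration of `P⁺ K`.
               ; control = let p , p∈ , eq = P⁺-control K ; k , at≡p = proj₂ In.range p∈
                           in k , trans (cong (c K) at≡p) eq }
    B = record { size = Out.size ; colour = c K ∘ Out.at
               ; control = let p , p∈ , eq = P⁻-control K ; k , at≡p = proj₂ Out.range p∈
                           in k , trans (cong (c K) at≡p) eq }

    K₂ K₃ K₄ : Computon
    K₂ = unit singleton A
    K₃ = unit B A
    K₄ = unit B singleton

  tailDiagram : TDiagram K
  tailDiagram = record
    { K₀ = trivial A ; K₁ = trivial B ; K₂ = K₂ ; K₃ = K₃ ; K₄ = K₄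
    ; K₀-trivial = trivial-trivial A ; K₁-trivial = trivial-trivial B
    ; K-connected = K-connected
    ; K₂-connected = unit-connected singleton A
    ; K₃-connected = unit-connected B A
    ; K₄-connected = unit-connected B singleton
    ; K₂⁻ = outMarker A K₂ inj₂ (λ _ → refl) inj₂-injective (unit-P⁻ singleton A)
    ; K₃⁻ = outMarker A K₃ inj₂ (λ _ → refl) inj₂-injective (unit-P⁻ B A)
    ; K⁺  = inMarker  A K In.at (λ _ → refl) In.injective In.range
    ; K₃⁺ = inMarker  B K₃ inj₁ (λ _ → refl) inj₁-injective (unit-P⁺ B A)
    ; K₄⁺ = inMarker  B K₄ inj₁ (λ _ → refl) inj₁-injective (unit-P⁺ B singleton)
    ; K⁻  = outMarker B K Out.at (λ _ → refl) Out.injective Out.range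
    }

  -- The glued computon

  private
    D : Diagram TShape
    D = TDiagram.diagram tailDiagram

    -- The markers identify every port of `K₃`, the e-outports of `K₂` and the e-inports of `K₄`
    -- with ports of `K`. Only the e-inport of `K₂` and the e-outport of `K₄` remain as new ports.
    Glued : Set
    Glued = Fin 1 ⊎ P K ⊎ Fin 1

    port : ∀ j → P (Diagram.obj D j) → Glued
    port v₀ k        = inj₂ (inj₁ (In.at k))
    port v₁ k        = inj₂ (inj₁ (Out.at k))
    port v  p        = inj₂ (inj₁ p)
    port v₂ (inj₁ x) = inj₁ x
    port v₂ (inj₂ k) = inj₂ (inj₁ (In.at k))
    port v₃ (inj₁ k) = inj₂ (inj₁ (Out.at k))
    port v₃ (inj₂ k) = inj₂ (inj₁ (In.at k))
    port v₄ (inj₁ k) = inj₂ (inj₁ (Out.at k))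
    port v₄ (inj₂ y) = inj₂ (inj₂ y)

    glued-colour : Glued → ℕ
    glued-colour = [ const 0 , [ c K , const 0 ] ]

  glued : Computon
  glued = record
    { U = U K₂ ⊎ U K ⊎ U K₃ ⊎ U K₄ ; P = Glued
    ; I = I K₂ ⊎ I K ⊎ I K₃ ⊎ I K₄ ; O = O K₂ ⊎ O K ⊎ O K₃ ⊎ O K₄
    ; U-finite = U-finite K₂ ⊎-finite U-finite K ⊎-finite U-finite K₃ ⊎-finite U-finite K₄
    ; P-finite = Fin-finite 1 ⊎-finite P-finite K ⊎-finite Fin-finite 1
    ; I-finite = I-finite K₂ ⊎-finite I-finite K ⊎-finite I-finite K₃ ⊎-finite I-finite K₄
    ; O-finite = O-finite K₂ ⊎-finite O-finite K ⊎-finite O-finite K₃ ⊎-finite O-finite K₄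
    ; P-point = inj₁ zero
    -- No colour is added: `A` and `B` are coloured by ports of `K`, and the two new ports have
    -- colour 0.
    ; Colours = Colours K ; 0∈Σ = 0∈Σ K
    ; σ = σ′ ; τ = τ′
    ; t = t′ ; s = s′
    ; c = glued-colour
    ; c-∈ = [ const (0∈Σ K) , [ c-∈ K , const (0∈Σ K) ] ]
    ; σ-surj = λ u → let o , _ , eq = σ₀ u in o , eq
    ; τ-surj = λ u → let i , _ , eq = τ₀ u in i , eq
    ; c-surj = λ n∈ → let p , eq = c-surj K n∈ in inj₂ (inj₁ p) , eq
    ; σ₀-surj = σ₀ ; τ₀-surj = τ₀
    -- The free port of `K₄` is the source of no edge; dually, the free port of `K₂` below is the
    -- target of none.
    ; P⁻-control = inj₂ (inj₂ zero) , (λ { (inj₁ _ , ())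
                                         ; (inj₂ (inj₁ _) , ())
                                         ; (inj₂ (inj₂ (inj₁ _)) , ())
                                         ; (inj₂ (inj₂ (inj₂ _)) , ()) }) , refl
    ; P⁺-control = inj₁ zero , (λ { (inj₁ _ , ())
                                  ; (inj₂ (inj₁ _) , ())
                                  ; (inj₂ (inj₂ (inj₁ _)) , ())
                                  ; (inj₂ (inj₂ (inj₂ _)) , ()) }) , refl
    }
    where
    σ′ = Sum.map (σ K₂) (Sum.map (σ K) (Sum.map (σ K₃) (σ K₄)))
    τ′ = Sum.map (τ K₂) (Sum.map (τ K) (Sum.map (τ K₃) (τ K₄)))
    t′ = [ port v₂ ∘ t K₂ , [ port v ∘ t K , [ port v₃ ∘ t K₃ , port v₄ ∘ t K₄ ] ] ]
    s′ = [ port v₂ ∘ s K₂ , [ port v ∘ s K , [ port v₃ ∘ s K₃ , port v₄ ∘ s K₄ ] ] ]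
    -- Gluing preserves colours by computation, so the control edge of a unit in its own summand
    -- remains a control edge.
    σ₀ : ∀ u → ∃[ o ] (glued-colour (t′ o) ≡ 0 × σ′ o ≡ u)
    σ₀ (inj₁ u)               = let o , c₀ , eq = σ₀-surj K₂ u in inj₁ o , c₀ , cong inj₁ eq
    σ₀ (inj₂ (inj₁ u))        = let o , c₀ , eq = σ₀-surj K u in inj₂ (inj₁ o) , c₀ , cong (inj₂ ∘ inj₁) eq
    σ₀ (inj₂ (inj₂ (inj₁ u))) = let o , c₀ , _ = σ₀-surj K₃ u in inj₂ (inj₂ (inj₁ o)) , c₀ , refl
    σ₀ (inj₂ (inj₂ (inj₂ u))) = let o , c₀ , _ = σ₀-surj K₄ u in inj₂ (inj₂ (inj₂ o)) , c₀ , refl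
    τ₀ : ∀ u → ∃[ i ] (glued-colour (s′ i) ≡ 0 × τ′ i ≡ u)
    τ₀ (inj₁ u)               = let i , c₀ , eq = τ₀-surj K₂ u in inj₁ i , c₀ , cong inj₁ eq
    τ₀ (inj₂ (inj₁ u))        = let i , c₀ , eq = τ₀-surj K u in inj₂ (inj₁ i) , c₀ , cong (inj₂ ∘ inj₁) eq
    τ₀ (inj₂ (inj₂ (inj₁ u))) = let i , c₀ , _ = τ₀-surj K₃ u in inj₂ (inj₂ (inj₁ i)) , c₀ , refl
    τ₀ (inj₂ (inj₂ (inj₂ u))) = let i , c₀ , _ = τ₀-surj K₄ u in inj₂ (inj₂ (inj₂ i)) , c₀ , refl

  -- The legs of the cocone

  private
    port-colour : ∀ j p → glued-colour (port j p) ≡ c (Diagram.obj D j) p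
    port-colour v₀ _        = refl
    port-colour v₁ _        = refl
    port-colour v  _        = refl
    port-colour v₂ (inj₁ _) = refl
    port-colour v₂ (inj₂ _) = refl
    port-colour v₃ (inj₁ _) = refl
    port-colour v₃ (inj₂ _) = refl
    port-colour v₄ (inj₁ _) = refl
    port-colour v₄ (inj₂ _) = refl

    -- Every colour is the colour of some port, and `port` carries that port into `glued`, whose
    -- colours are those of `K`.
    colours⊆ : ∀ j → Colours (Diagram.obj D j) List.⊆ Colours K
    colours⊆ j n∈ = let p , eq = c-surj (Diagram.obj D j) n∈
      in subst (_∈ˡ Colours K) (trans (port-colour j p) eq) (c-∈ glued (port j p))

    In-at∈ : ∀ {k p} → port v (In.at k) ≡ port v p → p ∈ P⁺ K
    In-at∈ {k} refl = proj₁ In.range (k , refl)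

    Out-at∈ : ∀ {k p} → port v (Out.at k) ≡ port v p → p ∈ P⁻ K
    Out-at∈ {k} refl = proj₁ Out.range (k , refl)

    legK : Transformation K glued
    legK = record
      { mapU = inj₂ ∘ inj₁ ; mapP = port v ; mapI = inj₂ ∘ inj₁ ; mapO = inj₂ ∘ inj₁
      ; Σ⊆ = id
      ; σ-natural = λ _ → refl ; τ-natural = λ _ → refl
      ; t-natural = λ _ → refl ; s-natural = λ _ → refl ; c-natural = λ _ → refl }

    -- Units outside `K` that produce into `K` belong to `K₂` or `K₃`, and their outputs are glued
    -- to e-inports of `K`; the output of `K₄` stays free. An edge of `K` itself adds no new unit.
    newPre : ∀ p → p ∈ i⃗ legK → p ∈ P⁺ K
    newPre _ (_ , (inj₁ _ , _ , eq) , _) = In-at∈ eq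
    newPre _ (_ , (inj₂ (inj₁ o) , refl , refl) , old) = contradiction (_ , (o , refl , refl) , refl) old
    newPre _ (_ , (inj₂ (inj₂ (inj₁ _)) , _ , eq) , _) = In-at∈ eq
    newPre _ (_ , (inj₂ (inj₂ (inj₂ _)) , _ , ()) , _)

    -- Dually, outside consumers belong to `K₃` or `K₄` and read e-outports of `K`; the input of
    -- `K₂` is the free port.
    newPost : ∀ p → p ∈ o⃗ legK → p ∈ P⁻ K
    newPost _ (_ , (inj₁ _ , () , _) , _)
    newPost _ (_ , (inj₂ (inj₁ i) , refl , refl) , old) = contradiction (_ , (i , refl , refl) , refl) old
    newPost _ (_ , (inj₂ (inj₂ (inj₁ _)) , eq , _) , _) = Out-at∈ eq
    newPost _ (_ , (inj₂ (inj₂ (inj₂ _)) , eq , _) , _) = Out-at∈ eq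

    legs : ∀ j → Morphism (Diagram.obj D j) glued
    legs v₀ = portMorphism A glued (port v₀) (λ _ → refl)
    legs v₁ = portMorphism B glued (port v₁) (λ _ → refl)
    legs v  = record { transformation = legK ; boundary = Sum.map (newPre _) (newPost _) }
    legs v₂ = record
      { transformation = record
          { mapU = inj₁ ; mapP = port v₂ ; mapI = inj₁ ; mapO = inj₁
          ; Σ⊆ = colours⊆ v₂
          ; σ-natural = λ _ → refl ; τ-natural = λ _ → refl
          ; t-natural = λ _ → refl ; s-natural = λ _ → refl ; c-natural = port-colour v₂ }
      ; boundary = λ {p} _ → unit-P⁺∪P⁻ singleton A p }
    legs v₃ = record
      { transformation = record
          { mapU = inj₂ ∘ inj₂ ∘ inj₁ ; mapP = port v₃
          ; mapI = inj₂ ∘ inj₂ ∘ inj₁ ; mapO = inj₂ ∘ inj₂ ∘ inj₁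
          ; Σ⊆ = colours⊆ v₃
          ; σ-natural = λ _ → refl ; τ-natural = λ _ → refl
          ; t-natural = λ _ → refl ; s-natural = λ _ → refl ; c-natural = port-colour v₃ }
      ; boundary = λ {p} _ → unit-P⁺∪P⁻ B A p }
    legs v₄ = record
      { transformation = record
          { mapU = inj₂ ∘ inj₂ ∘ inj₂ ; mapP = port v₄
          ; mapI = inj₂ ∘ inj₂ ∘ inj₂ ; mapO = inj₂ ∘ inj₂ ∘ inj₂
          ; Σ⊆ = colours⊆ v₄
          ; σ-natural = λ _ → refl ; τ-natural = λ _ → refl
          ; t-natural = λ _ → refl ; s-natural = λ _ → refl ; c-natural = port-colour v₄ }
      ; boundary = λ {p} _ → unit-P⁺∪P⁻ B singleton p }

  -- The cocone and its universality

  gluedCocone : Cocone D glued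
  gluedCocone = record
    { leg = legs
    ; commutes = λ
        { e₂⁻ → mk≈ₜ (λ ()) (λ _ → refl) (λ ()) (λ ())
        ; e₃⁻ → mk≈ₜ (λ ()) (λ _ → refl) (λ ()) (λ ())
        ; e⁺  → mk≈ₜ (λ ()) (λ _ → refl) (λ ()) (λ ())
        ; e₃⁺ → mk≈ₜ (λ ()) (λ _ → refl) (λ ()) (λ ())
        ; e₄⁺ → mk≈ₜ (λ ()) (λ _ → refl) (λ ()) (λ ())
        ; e⁻  → mk≈ₜ (λ ()) (λ _ → refl) (λ ()) (λ ()) } }

  glued-isColimit : IsColimit gluedCocone
  glued-isColimit = record
    { colimU = coproduct-colimit id id (λ _ → refl) (λ _ → refl) (λ _ → refl) (λ _ → refl)
    ; colimP = jointlySurjective⇒colimit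
        (λ { (inj₁ x)        → v₂ , inj₁ x , refl
           ; (inj₂ (inj₁ p)) → v  , p      , refl
           ; (inj₂ (inj₂ y)) → v₄ , inj₂ y , refl })
        -- The mediating map follows `g v` on the ports of `K`. A glued port of another computon is
        -- compared with `K` by going back to `v₀` or `v₁` along its marker and out again along that
        -- of `K`.
        λ g coh → [ g v₂ ∘ inj₁ , [ g v , g v₄ ∘ inj₂ ] ] , λ
          { v₀ k        → coh e⁺ k
          ; v₁ k        → coh e⁻ k
          ; v  _        → refl
          ; v₂ (inj₁ _) → refl
          ; v₂ (inj₂ k) → trans (coh e⁺ k) (sym (coh e₂⁻ k))
          ; v₃ (inj₁ k) → trans (coh e⁻ k) (sym (coh e₃⁺ k))
          ; v₃ (inj₂ k) → trans (coh e⁺ k) (sym (coh e₃⁻ k))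
          ; v₄ (inj₁ k) → trans (coh e⁻ k) (sym (coh e₄⁺ k))
          ; v₄ (inj₂ _) → refl }
    ; colimI = coproduct-colimit id id (λ _ → refl) (λ _ → refl) (λ _ → refl) (λ _ → refl)
    ; colimO = coproduct-colimit id id (λ _ → refl) (λ _ → refl) (λ _ → refl) (λ _ → refl)
    ; unionΣ = λ _ → mk⇔ (v ,_) λ { (j , n∈) → colours⊆ j n∈ }
    }

theorem5 : (K : Computon) → Connected K ⇔ (∃ λ (ρ : TDiagram K) → TailIterative ρ)
theorem5 K = mk⇔
  (λ conn → tailDiagram K conn , record { isColimit = glued-isColimit K conn })
  (λ { (ρ , _) → TDiagram.K-connected ρ })
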